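{- For every fixed integer $k\ge 2$ and every fixed $\epsilon>0$ there is a polynomial-time algorithm that, given any normalized $k$-ary string $s$ (say fully $k'$-ary for some $k'\le k$), computes a sequence of flips transforming $s$ into a string of length $k'$ using at most $(1+\epsilon)\,d_{\rm g}(s)$ flips.
   Context: Strings are finite words over $\{0,1,2,\dots\}$; a $k$-ary string uses only symbols from $\{0,\dots,k-1\}$. A string is \emph{normalized} if no two adjacent symbols are equal; the \emph{normalization} of a string replaces every maximal run of identical symbols by a single copy. A string is \emph{fully $k$-ary} if the set of symbols occurring in it is exactly $\{0,\dots,k-1\}$. For a normalized string $s=s_1\cdots s_n$ and $1\le i\le n$, the flip $f^{(i)}(s)$ is the normalization of $s_i\cdots s_1 s_{i+1}\cdots s_n$. The grouping distance $d_{\rm g}(s)$ of a normalized fully $k'$-ary string is the minimum number of flips needed to transform $s$ into a string of length $k'$. -}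

module Defs where

open import Data.Bool.Base using (Bool; true; false)
open import Data.Fin.Base using (Fin; toℕ; zero; suc)
open import Data.Fin.Properties using (_≟_)
open import Data.List.Base
  using (List; []; _∷_; _++_; length; take; drop; reverse; derun; concatMap; replicate; map)
open import Data.List.Membership.Propositional using (_∈_)
open import Data.List.Relation.Unary.Linked using (Linked)
open import Data.Maybe.Base as Maybe using (Maybe; just; nothing)
open import Data.Nat.Base using (ℕ; zero; suc; _+_; _*_; _^_; _≤_; _<_)
open import Data.Product.Base using (_×_; _,_; ∃-syntax; Σ-syntax)
open import Data.Vec.Base as Vec using (Vec)
open import Function.Bundles using (_↔_; _↣_; _⇔_; Injection)
open import Relation.Binary.PropositionalEquality.Core using (_≡_; _≢_)

------------------------------------------------------------------------
-- Strings, flips and the grouping distance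

-- k-ary strings.
Str : ℕ → Set
Str k = List (Fin k)

Normalized : ∀ {k} → Str k → Set
Normalized = Linked _≢_

-- `derun` collapses each maximal run of equal symbols to a single copy.
normalize : ∀ {k} → Str k → Str k
normalize = derun _≟_

FullyAry : ∀ {k} → ℕ → Str k → Set
FullyAry {k} k′ s = k′ ≤ k × (∀ (a : Fin k) → a ∈ s ⇔ toℕ a < k′)

-- The i-th flip; used only for 1 ≤ i ≤ length s.
flip : ∀ {k} → ℕ → Str k → Str k
flip i s = normalize (reverse (take i s) ++ drop i s)

-- s ⟶[ is ] t : performing the flips is, in order, is legal and turns s into t.
data _⟶[_]_ {k} : Str k → List ℕ → Str k → Set where
  done : ∀ {s} → s ⟶[ [] ] s
  step : ∀ {s t i is} → 1 ≤ i → i ≤ length s →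
         flip i s ⟶[ is ] t → s ⟶[ i ∷ is ] t

GroupedBy : ∀ {k} → ℕ → Str k → List ℕ → Set
GroupedBy {k} k′ s is = Σ[ t ∈ Str k ] (s ⟶[ is ] t × length t ≡ k′)

-- d is the minimum number of flips turning s into a string of length k′,
-- that is, d = d_g(s) when s is normalized and fully k′-ary.
IsGroupingDistance : ∀ {k} → ℕ → Str k → ℕ → Set
IsGroupingDistance k′ s d =
  (∃[ is ] (GroupedBy k′ s is × length is ≡ d)) ×
  (∀ is → GroupedBy k′ s is → d ≤ length is)

------------------------------------------------------------------------
-- Deterministic multi-tape Turing machines

Finite : Set → Set
Finite A = ∃[ n ] (A ↔ Fin n)

-- `nothing` is the blank symbol.
Cell : Set → Set
Cell Γ = Maybe Γ

-- A two-way infinite tape, all but finitely many cells of which are blank.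
-- Both lists start with the cell next to the head; the cells beyond their
-- ends are blank.
record Tape (Γ : Set) : Set where
  constructor tape
  field
    left  : List (Cell Γ)
    head  : Cell Γ
    right : List (Cell Γ)

open Tape public

data Move : Set where
  goLeft goRight stay : Move

write : ∀ {Γ} → Cell Γ → Tape Γ → Tape Γ
write x (tape l _ r) = tape l x r

move : ∀ {Γ} → Move → Tape Γ → Tape Γ
move goLeft  (tape []      h r)       = tape [] nothing (h ∷ r)
move goLeft  (tape (x ∷ l) h r)       = tape l x (h ∷ r)
move goRight (tape l       h [])      = tape (h ∷ l) nothing []
move goRight (tape l       h (x ∷ r)) = tape (h ∷ l) x r
move stay    t                        = t

act : ∀ {Γ} → Cell Γ × Move → Tape Γ → Tape Γ
act (x , m) t = move m (write x t)

blankTape : ∀ {Γ} → Tape Γ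
blankTape = tape [] nothing []

-- The tape holding the word w, with the head on its first letter.
wordTape : ∀ {Γ} → List Γ → Tape Γ
wordTape []      = blankTape
wordTape (a ∷ w) = tape [] (just a) (map just w)

upToBlank : ∀ {Γ} → List (Cell Γ) → List Γ
upToBlank []            = []
upToBlank (nothing ∷ _) = []
upToBlank (just a ∷ w)  = a ∷ upToBlank w

-- The word that starts at the head and extends right to the first blank.
tapeWord : ∀ {Γ} → Tape Γ → List Γ
tapeWord t = upToBlank (head t ∷ right t)

-- Machines with input alphabet I and output alphabet O. Tape 0 is the input
-- tape, tape 1 the output tape, and there are `work` further tapes. The
-- machine halts when δ returns `nothing`.
record Machine (I O : Set) : Set₁ where
  field
    work         : ℕ
    State        : Set
    Γ            : Set
    finite-State : Finite State
    finite-Γ     : Finite Γ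
    inLetter     : I ↣ Γ
    outLetter    : O ↣ Γ
    start        : State
    δ            : State → Vec (Cell Γ) (2 + work) →
                   Maybe (State × Vec (Cell Γ × Move) (2 + work))

module _ {I O : Set} (M : Machine I O) where
  open Machine M

  record Config : Set where
    constructor config
    field
      state : State
      tapes : Vec (Tape Γ) (2 + work)

  open Config

  initial : List I → Config
  initial w = config start
    (wordTape (map (Injection.to inLetter) w) Vec.∷ Vec.replicate (1 + work) blankTape)

  stepConfig : Config → Maybe Config
  stepConfig (config q ts) =
    Maybe.map (λ (q′ , as) → config q′ (Vec.zipWith act as ts)) (δ q (Vec.map head ts))

  -- c ⇓[ n ] c′ : started in c, the machine halts in c′ after exactly n steps.
  data _⇓[_]_ : Config → ℕ → Config → Set where
    halt : ∀ {c} → stepConfig c ≡ nothing → c ⇓[ 0 ] c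
    next : ∀ {c c′ c″ n} → stepConfig c ≡ just c′ → c′ ⇓[ n ] c″ → c ⇓[ suc n ] c″

  outputs : Config → List O → Set
  outputs c w =
    tapeWord (Vec.lookup (tapes c) (suc zero)) ≡ map (Injection.to outLetter) w

  -- On input w the machine halts after n steps with output u.
  ComputesIn : ℕ → List I → List O → Set
  ComputesIn n w u = ∃[ c ] (initial w ⇓[ n ] c × outputs c u)

-- Polynomial-time solvability of a search problem: on every input w
-- satisfying the promise P, the machine outputs (the code of) some answer y
-- with R w y, within a number of steps polynomial in the length of w.
PolyTimeSolvable : ∀ {I O Y : Set} → (Y → List O) →
                   (List I → Set) → (List I → Y → Set) → Set₁
PolyTimeSolvable {I} {O} {Y} code P R =
  Σ[ M ∈ Machine I O ] ∃[ c ] ∃[ e ] (∀ (w : List I) → P w →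
    Σ[ y ∈ Y ] ∃[ n ] (ComputesIn M n w (code y) × n ≤ c * length w ^ e + c × R w y))

-- Flip sequences are output in unary, each index i as i letters `true`
-- followed by `false`. Indices never exceed the length of the input string,
-- so this differs from a binary code only polynomially.
codeFlips : List ℕ → List Bool
codeFlips = concatMap (λ i → replicate i true ++ false ∷ [])

{-# OPTIONS --safe #-}

-- A flip shortens a normalized string by at most one symbol, so d_g(s) ≥ n − k′ for
-- a string s of length n.  Conversely n flips suffice: writing s = a u v with a ∉ u
-- and v empty or starting with a, the flip at 1 + |u| merges the leading a into v,
-- or else moves it to its final place at the end; in both cases the algorithm
-- continues with the string reverse(u) v, which is one symbol shorter.  Hence this
-- greedy algorithm is a (1 + ε)-approximation for all but the finitely many strings
-- with ε d_g(s) < k, and optimal answers for those are stored in the finite control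
-- of the machine.
module Submission where

open import Defs
open import Data.Nat.Base using (ℕ; _≤_)
open import Data.Integer.Base using (+_)
open import Data.Rational.Base using (ℚ; 0ℚ; 1ℚ; _/_) renaming (_+_ to _+ℚ_; _*_ to _*ℚ_; _≤_ to _≤ℚ_; _<_ to _<ℚ_)
open import Data.List.Base using (length)
open import Data.Product.Base using (_×_; ∃-syntax)
open import Data.Bool.Base using (Bool; true; false)
open import Data.Fin.Base using (Fin; toℕ; inject≤; fromℕ<)
open import Data.Fin.Patterns using (0F; 1F; 2F; 3F; 4F; 5F)
open import Data.Fin.Properties
  using (_≟_; toℕ<n; toℕ-inject≤; inject≤-injective; toℕ-injective; toℕ-fromℕ<; +↔⊎; *↔×; 1↔⊤; 2↔Bool)
open import Data.Integer.Base as ℤ using (+0; -[1+_])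
import Data.Integer.Properties as ℤ
open import Data.List.Base
  using (List; []; _∷_; [_]; _++_; take; drop; reverse; _ʳ++_; replicate; map; tabulate)
open import Data.List.Membership.Propositional using (_∈_; _∉_)
open import Data.List.Membership.Propositional.Properties
  using (∈-derun⁺; ∈-derun⁻; ∈-++⁺ˡ; ∈-++⁺ʳ; ∈-++⁻; ∈-tabulate⁺; ∈-tabulate⁻)
open import Data.List.Membership.Propositional.Properties.WithK using (unique∧set⇒bag)
open import Data.List.Properties
  using (++-assoc; ++-identityʳ; length-++; length-++-≤ˡ; length-reverse; length-derun;
    length-replicate; length-tabulate; ʳ++-defn; length-ʳ++; ʳ++-ʳ++; ++-ʳ++; map-++; take++drop≡id;
    take-all; length-take; map-∘; reverse-map)
open import Data.List.Relation.Binary.BagAndSetEquality using (∼bag⇒↭)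
open import Data.List.Relation.Binary.Disjoint.Propositional using (Disjoint)
open import Data.List.Relation.Binary.Permutation.Propositional.Properties using (↭-length)
open import Data.List.Relation.Unary.All as All using (All; []; _∷_)
open import Data.List.Relation.Unary.All.Properties using (¬Any⇒All¬; All¬⇒¬Any)
open import Data.List.Relation.Unary.AllPairs using ([]; _∷_)
open import Data.List.Relation.Unary.Any using (here; there)
open import Data.List.Relation.Unary.Any.Properties using (reverse⁺; reverse⁻)
open import Data.List.Relation.Unary.Linked as Linked using (Linked; []; [-]; _∷_; linked?)
open import Data.List.Relation.Unary.Unique.Propositional using (Unique)
open import Data.List.Relation.Unary.Unique.Propositional.Properties using (tabulate⁺)
open import Data.Maybe.Base using (Maybe; just; nothing)
open import Data.Nat.Base using (zero; suc; _+_; _*_; _^_; _<_; z≤n; s≤s)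
open import Data.Nat.Coprimality using (Coprime)
open import Data.Nat.Properties as ℕ using (≤-refl; ≤-trans; module ≤-Reasoning; _≤?_)
open import Data.Nat.Solver using (module +-*-Solver)
open import Data.Product.Base using (_,_; Σ-syntax; proj₁; proj₂)
open import Data.Product.Function.NonDependent.Propositional using (_×-↔_)
open import Data.Rational.Base as ℚ using (mkℚ; *<*)
import Data.Rational.Properties as ℚ
open import Data.Rational.Unnormalised.Base as ℚᵘ using (mkℚᵘ; *≤*)
import Data.Rational.Unnormalised.Properties as ℚᵘ
open import Data.Sum.Base using (_⊎_; inj₁; inj₂)
open import Data.Sum.Function.Propositional using (_⊎-↔_)
open import Data.Sum.Properties using (inj₁-injective; inj₂-injective)
open import Data.Unit.Base using (⊤; tt)
open import Data.Vec.Base using (Vec; []; _∷_)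
open import Function.Base using (_∘_; _∋_)
open import Function.Bundles using (_⇔_; mk⇔; Equivalence; mk↣)
open import Function.Construct.Composition using (_↔-∘_)
open import Function.Construct.Identity using (↔-id)
open import Function.Construct.Symmetry using (↔-sym)
open import Level using (0ℓ)
open import Relation.Binary.Core using (Rel)
open import Relation.Binary.Definitions using (Symmetric)
open import Relation.Binary.PropositionalEquality
  using (_≡_; _≢_; refl; sym; trans; cong; cong₂; subst; ≢-sym; module ≡-Reasoning; subst₂)
open import Relation.Nullary using (Dec; yes; no; contradiction; ¬?)
open import Relation.Nullary.Decidable using (map′)
open +-*-Solver using (solve; con; _:+_; _:*_; _:=_)

least : ∀ {Q : ℕ → Set} → (∀ n → Dec (Q n)) → ∀ n → Q n → ∃[ m ] (Q m × (∀ j → Q j → m ≤ j))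
least Q? zero    q = zero , q , λ _ _ → z≤n
least Q? (suc n) q with Q? zero
... | yes q₀ = zero , q₀ , λ _ _ → z≤n
... | no ¬q₀ with least (λ m → Q? (suc m)) n q
...   | m , qm , min = suc m , qm , λ { zero q₀ → contradiction q₀ ¬q₀ ; (suc j) qj → s≤s (min j qj) }

-- Flips and the greedy algorithm

module _ {A : Set} {R : Rel A 0ℓ} where

  Linked-++⁻ˡ : ∀ xs {ys} → Linked R (xs ++ ys) → Linked R xs
  Linked-++⁻ˡ []           _        = []
  Linked-++⁻ˡ (x ∷ [])     _        = [-]
  Linked-++⁻ˡ (x ∷ y ∷ xs) (r ∷ rs) = r ∷ Linked-++⁻ˡ (y ∷ xs) rs

  Linked-++⁻ʳ : ∀ xs {ys} → Linked R (xs ++ ys) → Linked R ys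
  Linked-++⁻ʳ []       l = l
  Linked-++⁻ʳ (x ∷ xs) l = Linked-++⁻ʳ xs (Linked.tail l)

  -- Since `a` precedes both `xs` and `ys`, reversing `xs` in front of `a` only creates pairs of
  -- neighbours that were neighbours before, possibly in the other order.
  Linked-ʳ++⁺ : Symmetric R → ∀ xs {a ys} →
                Linked R (a ∷ xs) → Linked R (a ∷ ys) → Linked R (xs ʳ++ a ∷ ys)
  Linked-ʳ++⁺ R-sym []       _        l = l
  Linked-ʳ++⁺ R-sym (x ∷ xs) (r ∷ rs) l = Linked-ʳ++⁺ R-sym xs rs (R-sym r ∷ l)

module _ {k : ℕ} where

  private
    variable
      s t x P : Str k
      a : Fin k
      is : List ℕ

  ∉⇒Linked-∷ : a ∉ s → Normalized s → Normalized (a ∷ s)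
  ∉⇒Linked-∷ {s = []}    _   _ = [-]
  ∉⇒Linked-∷ {s = _ ∷ _} a∉s l = (λ a≡b → a∉s (here a≡b)) ∷ l

  normalize-id : Normalized s → normalize s ≡ s
  normalize-id []  = refl
  normalize-id [-] = refl
  normalize-id {x ∷ y ∷ _} (x≢y ∷ l) with x ≟ y
  ... | yes x≡y = contradiction x≡y x≢y
  ... | no  _   = cong (x ∷_) (normalize-id l)

  -- For the flip that brings the leading letter next to a later copy of itself. `derun` compares
  -- adjacent letters, so a one-letter prefix, whose neighbour is the first `a`, is a case of its
  -- own.
  normalize-repeat : ∀ (xs : Str k) a {ys} → normalize (xs ++ a ∷ a ∷ ys) ≡ normalize (xs ++ a ∷ ys)
  normalize-repeat [] a with a ≟ a
  ... | yes _  = refl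
  ... | no a≢a = contradiction refl a≢a
  normalize-repeat (x ∷ []) a {ys} with x ≟ a | normalize-repeat [] a {ys}
  ... | yes _ | ih = ih
  ... | no  _ | ih = cong (x ∷_) ih
  normalize-repeat (x ∷ y ∷ xs) a {ys} with x ≟ y | normalize-repeat (y ∷ xs) a {ys}
  ... | yes _ | ih = ih
  ... | no  _ | ih = cong (x ∷_) ih

  normalize-Normalized : ∀ (s : Str k) → Normalized (normalize s)
  normalize-Normalized []           = []
  normalize-Normalized (x ∷ [])     = [-]
  normalize-Normalized (x ∷ y ∷ xs) with x ≟ y | normalize-Normalized (y ∷ xs)
  ... | yes _  | ih = ih
  ... | no x≢y | ih = cons xs x≢y ih
    where
    -- `derun` keeps the last copy of a run, so the head of `normalize (y ∷ xs)` shows only at the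
    -- end of the run of `y`; the recursion walks along that run.
    cons : ∀ xs {x y} → x ≢ y → Normalized (normalize (y ∷ xs)) → Normalized (x ∷ normalize (y ∷ xs))
    cons []       x≢y l = x≢y ∷ l
    cons (z ∷ xs) {y = y} x≢y l with y ≟ z
    ... | yes refl = cons xs x≢y l
    ... | no  _    = x≢y ∷ l

  -- Two equal neighbours can only occur at the junction of the two normalized words, so at most one
  -- symbol collapses.
  length-normalize-++ : ∀ (xs ys : Str k) → Normalized xs → Normalized ys →
                        length xs + length ys ≤ suc (length (normalize (xs ++ ys)))
  length-normalize-++ [] ys _ lys = ℕ.m≤n⇒m≤1+n (ℕ.≤-reflexive (cong length (sym (normalize-id lys))))
  length-normalize-++ (x ∷ []) []       _ _   = s≤s z≤n
  length-normalize-++ (x ∷ []) (y ∷ ys) _ lys with x ≟ y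
  ... | yes _ = s≤s (ℕ.≤-reflexive (cong length (sym (normalize-id lys))))
  ... | no  _ = s≤s (ℕ.m≤n⇒m≤1+n (ℕ.≤-reflexive (cong length (sym (normalize-id lys)))))
  length-normalize-++ (x ∷ y ∷ xs) ys (x≢y ∷ lxs) lys with x ≟ y
  ... | yes x≡y = contradiction x≡y x≢y
  ... | no  _   = s≤s (length-normalize-++ (y ∷ xs) ys lxs lys)

  take-length-++ : ∀ (xs : Str k) {ys} → take (length xs) (xs ++ ys) ≡ xs
  take-length-++ []       = refl
  take-length-++ (x ∷ xs) = cong (x ∷_) (take-length-++ xs)

  drop-length-++ : ∀ (xs : Str k) {ys} → drop (length xs) (xs ++ ys) ≡ ys
  drop-length-++ []       = refl
  drop-length-++ (x ∷ xs) = drop-length-++ xs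

  flip-length-++ : ∀ (xs : Str k) {ys} → flip (length xs) (xs ++ ys) ≡ normalize (xs ʳ++ ys)
  flip-length-++ xs {ys} = cong normalize (trans
    (cong₂ (λ p q → reverse p ++ q) (take-length-++ xs) (drop-length-++ xs))
    (sym (ʳ++-defn xs)))

  Normalized-reverse : Normalized s → Normalized (reverse s)
  Normalized-reverse []        = []
  Normalized-reverse [-]       = [-]
  Normalized-reverse l@(_ ∷ _) = Linked-ʳ++⁺ ≢-sym _ l [-]

  length-flip-≤ : ∀ i (s : Str k) → length (flip i s) ≤ length s
  length-flip-≤ i s = begin
    length (flip i s)                           ≤⟨ length-derun _≟_ (reverse (take i s) ++ drop i s) ⟩
    length (reverse (take i s) ++ drop i s)     ≡⟨ length-++ (reverse (take i s)) ⟩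
    length (reverse (take i s)) + length (drop i s)
      ≡⟨ cong (_+ length (drop i s)) (length-reverse (take i s)) ⟩
    length (take i s) + length (drop i s)       ≡⟨ length-++ (take i s) ⟨
    length (take i s ++ drop i s)               ≡⟨ cong length (take++drop≡id i s) ⟩
    length s                                    ∎
    where open ≤-Reasoning

  length-flip-≥ : ∀ i → Normalized s → length s ≤ suc (length (flip i s))
  length-flip-≥ {s = s} i l = begin
    length s                                    ≡⟨ cong length (take++drop≡id i s) ⟨
    length (take i s ++ drop i s)               ≡⟨ length-++ (take i s) ⟩
    length (take i s) + length (drop i s)
      ≡⟨ cong (_+ length (drop i s)) (length-reverse (take i s)) ⟨
    length (reverse (take i s)) + length (drop i s)
      ≤⟨ length-normalize-++ (reverse (take i s)) (drop i s)
           (Normalized-reverse (Linked-++⁻ˡ (take i s) l′)) (Linked-++⁻ʳ (take i s) l′) ⟩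
    suc (length (flip i s))                     ∎
    where
    open ≤-Reasoning
    l′ : Normalized (take i s ++ drop i s)
    l′ = subst Normalized (sym (take++drop≡id i s)) l

  ∈-flip : ∀ i → a ∈ s ⇔ a ∈ flip i s
  ∈-flip {a} {s} i = mk⇔ to from
    where
    to : a ∈ s → a ∈ flip i s
    to a∈s with ∈-++⁻ (take i s) (subst (a ∈_) (sym (take++drop≡id i s)) a∈s)
    ... | inj₁ p = ∈-derun⁺ _≟_ (∈-++⁺ˡ (reverse⁺ p))
    ... | inj₂ p = ∈-derun⁺ _≟_ (∈-++⁺ʳ (reverse (take i s)) p)
    from : a ∈ flip i s → a ∈ s
    from a∈f with ∈-++⁻ (reverse (take i s)) (∈-derun⁻ _≟_ _ a∈f)
    ... | inj₁ p = subst (a ∈_) (take++drop≡id i s) (∈-++⁺ˡ (reverse⁻ {xs = take i s} p))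
    ... | inj₂ p = subst (a ∈_) (take++drop≡id i s) (∈-++⁺ʳ (take i s) p)

  ∈-⟶ : s ⟶[ is ] t → a ∈ s ⇔ a ∈ t
  ∈-⟶ done = mk⇔ (λ p → p) (λ p → p)
  ∈-⟶ (step {i = i} _ _ r) = mk⇔
    (Equivalence.to (∈-⟶ r) ∘ Equivalence.to (∈-flip i))
    (Equivalence.from (∈-flip i) ∘ Equivalence.from (∈-⟶ r))

  length-⟶-≥ : Normalized s → s ⟶[ is ] t → length s ≤ length is + length t
  length-⟶-≥ l done = ≤-refl
  length-⟶-≥ {s} l (step {i = i} _ _ r) =
    ≤-trans (length-flip-≥ i l) (s≤s (length-⟶-≥ (normalize-Normalized (reverse (take i s) ++ drop i s)) r))

  -- An index is bounded by the length of the current string, and no flip lengthens a string. This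
  -- bounds the unary code of the output.
  indices-≤ : s ⟶[ is ] t → All (_≤ length s) is
  indices-≤ done                           = []
  indices-≤ {s} (step {i = i} _ i≤n r) =
    i≤n ∷ All.map (λ j≤ → ≤-trans j≤ (length-flip-≤ i s)) (indices-≤ r)

  -- The greedy algorithm: rounds, correctness and number of flips

  data Split (a : Fin k) : Str k → Set where
    absent  : ∀ u → All (a ≢_) u → Split a u
    present : ∀ u → All (a ≢_) u → ∀ v → Split a (u ++ a ∷ v)

  split : ∀ a s → Split a s
  split a [] = absent [] []
  split a (b ∷ s) with a ≟ b
  ... | yes refl = present [] [] s
  ... | no a≢b with split a s
  ...   | absent  u a∉u   = absent (b ∷ u) (a≢b ∷ a∉u)
  ...   | present u a∉u v = present (b ∷ u) (a≢b ∷ a∉u) v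

  block : Split a s → Str k
  block (absent u _)    = u
  block (present u _ _) = u

  -- The string that is still to be treated once the leading `a` is gone: settled at the end in the
  -- first case, merged with its next copy in the second.
  next-round : Split a s → Str k
  next-round         (absent u _)    = reverse u
  next-round {a = a} (present u _ v) = u ʳ++ a ∷ v

  length-next-round : (p : Split a s) → length (next-round p) ≡ length s
  length-next-round (absent u _)    = length-reverse u
  length-next-round (present u _ v) = trans (length-ʳ++ u) (sym (length-++ u))

  length-block-≤ : (p : Split a s) → length (block p) ≤ length s
  length-block-≤ (absent u _)    = ≤-refl
  length-block-≤ (present u _ v) = length-++-≤ˡ u

  -- The first argument is fuel; it is meant to be the length of the string.
  greedy : ℕ → Str k → List ℕ
  greedy zero    _       = []
  greedy (suc n) []      = []
  greedy (suc n) (a ∷ s) = suc (length (block (split a s))) ∷ greedy n (next-round (split a s))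

  length-greedy : ∀ n (s : Str k) → length s ≡ n → length (greedy n s) ≡ n
  length-greedy zero    _       _ = refl
  length-greedy (suc n) (a ∷ s) e =
    cong suc (length-greedy n (next-round (split a s)) (trans (length-next-round (split a s)) (ℕ.suc-injective e)))

  ʳ++-++ : ∀ (xs : Str k) {ys zs} → (xs ʳ++ ys) ++ zs ≡ xs ʳ++ ys ++ zs
  ʳ++-++ []       = refl
  ʳ++-++ (x ∷ xs) = ʳ++-++ xs

  ∈-ʳ++⁻ : ∀ u {v} → a ∈ u ʳ++ v → a ∈ u ++ v
  ∈-ʳ++⁻ u {v} p with ∈-++⁻ (reverse u) (subst (_ ∈_) (ʳ++-defn u) p)
  ... | inj₁ q = ∈-++⁺ˡ (reverse⁻ {xs = u} q)
  ... | inj₂ q = ∈-++⁺ʳ u q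

  -- P consists of the letters that have already been moved to their final place.
  greedy-groups : ∀ n (x P : Str k) → length x ≡ n → Normalized (x ++ P) → Unique P → Disjoint x P →
                  Σ[ t ∈ Str k ] ((x ++ P) ⟶[ greedy n x ] t × Unique t)
  greedy-groups zero    []      P _ _ uP _ = P , done , uP
  greedy-groups (suc n) (a ∷ s) P e l uP dis with split a s
  ... | p@(absent u a∉u) =
        let t , r , ut = greedy-groups n (reverse u) (a ∷ P)
              (trans (length-next-round p) (ℕ.suc-injective e))
              (subst Normalized (ʳ++-defn u) l′)
              (¬Any⇒All¬ _ a∉P ∷ uP)
              (λ { (p , here refl) → All¬⇒¬Any a∉u (reverse⁻ p)
                 ; (p , there q)   → dis (there (reverse⁻ p) , q) })
        in  t , step (s≤s z≤n) (s≤s (length-++-≤ˡ u)) (subst (_⟶[ greedy n (reverse u) ] t) (sym flip≡) r) , ut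
    where
    a∉P : a ∉ P
    a∉P p = dis (here refl , p)
    -- The only new junction is between `a` and `P`, and `a` does not occur in `P`; hence this flip
    -- collapses nothing.
    l′ : Normalized (u ʳ++ a ∷ P)
    l′ = Linked-ʳ++⁺ ≢-sym u (Linked-++⁻ˡ (a ∷ u) l) (∉⇒Linked-∷ a∉P (Linked-++⁻ʳ (a ∷ u) l))
    flip≡ : flip (suc (length u)) (a ∷ u ++ P) ≡ reverse u ++ a ∷ P
    flip≡ = trans (flip-length-++ (a ∷ u)) (trans (normalize-id l′) (ʳ++-defn u))
  ... | p@(present u a∉u v) =
        let t , r , ut = greedy-groups n (u ʳ++ a ∷ v) P
              (trans (length-next-round p) (ℕ.suc-injective e))
              (subst Normalized (sym (ʳ++-++ u)) l′)
              uP
              (λ (p , q) → dis (there (∈-ʳ++⁻ u p) , q))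
        in  t , step (s≤s z≤n)
                  (s≤s (subst (λ z → length u ≤ length z) (sym (++-assoc u (a ∷ v) P)) (length-++-≤ˡ u)))
                  (subst (_⟶[ greedy n (u ʳ++ a ∷ v) ] t) (sym flip≡) r) , ut
    where
    l₁ : Normalized (a ∷ u ++ a ∷ v ++ P)
    l₁ = subst (λ z → Normalized (a ∷ z)) (++-assoc u (a ∷ v) P) l
    -- The block `u` has an `a` on both sides, so after its reversal it is again followed by an `a`
    -- that differs from its last letter.
    l′ : Normalized (u ʳ++ a ∷ v ++ P)
    l′ = Linked-ʳ++⁺ ≢-sym u (Linked-++⁻ˡ (a ∷ u) l₁) (Linked-++⁻ʳ (a ∷ u) l₁)
    open ≡-Reasoning
    flip≡ : flip (suc (length u)) (a ∷ (u ++ a ∷ v) ++ P) ≡ (u ʳ++ a ∷ v) ++ P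
    flip≡ = begin
      flip (suc (length u)) (a ∷ (u ++ a ∷ v) ++ P)
        ≡⟨ cong (λ z → flip (suc (length u)) (a ∷ z)) (++-assoc u (a ∷ v) P) ⟩
      flip (suc (length u)) (a ∷ u ++ a ∷ v ++ P) ≡⟨ flip-length-++ (a ∷ u) ⟩
      normalize (u ʳ++ a ∷ a ∷ v ++ P)            ≡⟨ cong normalize (ʳ++-defn u) ⟩
      -- The leading `a` has landed next to its first later copy, and the two collapse.
      normalize (reverse u ++ a ∷ a ∷ v ++ P)     ≡⟨ normalize-repeat (reverse u) a ⟩
      normalize (reverse u ++ a ∷ v ++ P)         ≡⟨ cong normalize (ʳ++-defn u) ⟨
      normalize (u ʳ++ a ∷ v ++ P)                ≡⟨ normalize-id l′ ⟩
      u ʳ++ a ∷ v ++ P                            ≡⟨ ʳ++-++ u ⟨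
      (u ʳ++ a ∷ v) ++ P                          ∎

  -- Both `t` and the list of the first `k′` symbols are free of repetitions and have the same
  -- elements, so they are permutations of each other.
  length-Unique-FullyAry : ∀ {k′} → Unique t → FullyAry k′ t → length t ≡ k′
  length-Unique-FullyAry {t} {k′} ut (k′≤k , full) =
    trans (↭-length (∼bag⇒↭ (unique∧set⇒bag ut uq (λ {a} → mk⇔ (to a) (from a)))))
          (length-tabulate initials)
    where
    initials : Fin k′ → Fin k
    initials i = inject≤ i k′≤k
    uq : Unique (tabulate initials)
    uq = tabulate⁺ (inject≤-injective k′≤k k′≤k _ _)
    to : ∀ a → a ∈ t → a ∈ tabulate initials
    to a p = subst (_∈ tabulate initials)
      (toℕ-injective (trans (toℕ-inject≤ _ k′≤k) (toℕ-fromℕ< a<k′)))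
      (∈-tabulate⁺ {f = initials} (fromℕ< a<k′))
      where
      a<k′ : toℕ a < k′
      a<k′ = Equivalence.to (full a) p
    from : ∀ a → a ∈ tabulate initials → a ∈ t
    from a p with ∈-tabulate⁻ {f = initials} p
    ... | i , refl = Equivalence.from (full _) (subst (_< k′) (sym (toℕ-inject≤ i k′≤k)) (toℕ<n i))

  FullyAry-⟶ : ∀ {k′} → s ⟶[ is ] t → FullyAry k′ s → FullyAry k′ t
  FullyAry-⟶ r (k′≤k , full) = k′≤k , λ a → mk⇔
    (Equivalence.to (full a) ∘ Equivalence.from (∈-⟶ r))
    (Equivalence.to (∈-⟶ r) ∘ Equivalence.from (full a))

  -- Uniqueness, unlike the length of the result, can be stated before any `k′` is given; `optimal`
  -- later takes its target length from this `t`.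
  grouped : Normalized s → Σ[ t ∈ Str k ] (s ⟶[ greedy (length s) s ] t × Unique t)
  grouped {s} l =
    subst (λ z → Σ[ t ∈ Str k ] (z ⟶[ greedy (length s) s ] t × Unique t)) (++-identityʳ s)
      (greedy-groups (length s) s [] refl (subst Normalized (sym (++-identityʳ s)) l) [] (λ ()))

  greedy-GroupedBy : ∀ {k′} → Normalized s → FullyAry k′ s → GroupedBy k′ s (greedy (length s) s)
  greedy-GroupedBy l full with grouped l
  ... | t , r , ut = t , r , length-Unique-FullyAry ut (FullyAry-⟶ r full)

  -- Deciding by exhaustive search whether `d` flips suffice

  Groupable : ℕ → ℕ → Str k → Set
  Groupable k′ d s = ∃[ is ] (GroupedBy k′ s is × length is ≡ d)

  -- Each step has only `length s` legal indices to try; they start at 1, whence the `suc i`.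
  -- Together with `least` this yields optimal sequences.
  groupable? : ∀ k′ d s → Dec (Groupable k′ d s)
  groupable? k′ zero s = map′
    (λ e → [] , (s , done , e) , refl)
    (λ { ([] , (_ , done , e) , _) → e })
    (length s ℕ.≟ k′)
  groupable? k′ (suc d) s = map′
    (λ (i , i<n , is , (t , r , e) , e′) → suc i ∷ is , (t , step (s≤s z≤n) i<n r , e) , cong suc e′)
    (λ { (suc i ∷ is , (t , step _ i<n r , e) , e′) → i , i<n , is , (t , r , e) , ℕ.suc-injective e′ })
    (ℕ.anyUpTo? (λ i → groupable? k′ d (flip (suc i) s)) (length s))

-- Finite control and tapes

private
  variable
    A B : Set

finite-Fin : ∀ n → Finite (Fin n)
finite-Fin n = n , ↔-id _

finite-⊤ : Finite ⊤
finite-⊤ = 1 , ↔-sym 1↔⊤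

finite-Bool : Finite Bool
finite-Bool = 2 , ↔-sym 2↔Bool

finite-⊎ : Finite A → Finite B → Finite (A ⊎ B)
finite-⊎ (m , f) (n , g) = m + n , ↔-sym +↔⊎ ↔-∘ (f ⊎-↔ g)

finite-× : Finite A → Finite B → Finite (A × B)
finite-× (m , f) (n , g) = m * n , ↔-sym *↔× ↔-∘ (f ×-↔ g)

-- Lists of length at most `n`, encoded by nested sums and products so that finiteness is inherited
-- from `A`.
Bounded : Set → ℕ → Set
Bounded A zero    = ⊤
Bounded A (suc n) = ⊤ ⊎ (A × Bounded A n)

finite-Bounded : Finite A → ∀ n → Finite (Bounded A n)
finite-Bounded f zero    = finite-⊤
finite-Bounded f (suc n) = finite-⊎ finite-⊤ (finite-× f (finite-Bounded f n))

truncate : ∀ n → List A → Bounded A n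
truncate zero    _        = tt
truncate (suc n) []       = inj₁ tt
truncate (suc n) (x ∷ xs) = inj₂ (x , truncate n xs)

toList : ∀ n → Bounded A n → List A
toList zero    _              = []
toList (suc n) (inj₁ _)       = []
toList (suc n) (inj₂ (x , b)) = x ∷ toList n b

toList-truncate : ∀ n (xs : List A) → toList n (truncate n xs) ≡ take n xs
toList-truncate zero    _        = refl
toList-truncate (suc n) []       = refl
toList-truncate (suc n) (x ∷ xs) = cong (x ∷_) (toList-truncate n xs)

-- Letters of `xs` that are cut off lie beyond position `n`, and so does everything appended after
-- them. Hence a state holding a truncated prefix can be updated letter by letter.
truncate-toList-++ : ∀ n (xs ys : List A) → truncate n (toList n (truncate n xs) ++ ys) ≡ truncate n (xs ++ ys)
truncate-toList-++ zero    _        _  = refl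
truncate-toList-++ (suc n) []       ys = refl
truncate-toList-++ (suc n) (x ∷ xs) ys = cong (λ b → inj₂ (x , b)) (truncate-toList-++ n xs ys)

-- `move` distinguishes whether the side it enters is empty. `fromHead` and `upToHead` absorb this
-- distinction by putting the head on the first cell of a list, or on a blank if there is none.
fromHead : List (Cell A) → List (Cell A) → Tape A
fromHead l []      = tape l nothing []
fromHead l (c ∷ r) = tape l c r

upToHead : List (Cell A) → List (Cell A) → Tape A
upToHead []      r = tape [] nothing r
upToHead (c ∷ l) r = tape l c r

move-goRight : ∀ l (h : Cell A) r → move goRight (tape l h r) ≡ fromHead (h ∷ l) r
move-goRight l h []      = refl
move-goRight l h (_ ∷ _) = refl

move-goLeft : ∀ l (h : Cell A) r → move goLeft (tape l h r) ≡ upToHead l (h ∷ r)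
move-goLeft []      h r = refl
move-goLeft (_ ∷ _) h r = refl

wordTape-fromHead : ∀ (w : List A) → wordTape w ≡ fromHead [] (map just w)
wordTape-fromHead []      = refl
wordTape-fromHead (_ ∷ _) = refl

tapeWord-fromHead : ∀ l (w : List A) r → tapeWord (fromHead l (map just w ++ nothing ∷ r)) ≡ w
tapeWord-fromHead l []      r = refl
tapeWord-fromHead l (a ∷ w) r = cong (a ∷_) (upToBlank-++ w)
  where
  upToBlank-++ : ∀ w → upToBlank (map just w ++ nothing ∷ r) ≡ w
  upToBlank-++ []      = refl
  upToBlank-++ (a ∷ w) = cong (a ∷_) (upToBlank-++ w)

reverse-ʳ++ : ∀ (xs ys : List A) → reverse xs ʳ++ ys ≡ xs ++ ys
reverse-ʳ++ xs ys = ʳ++-ʳ++ xs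

-- Strings of length at most N are answered from a table held in the finite
-- control, whose entries have length at most L; longer ones by simulating greedy.
module GreedyMachine (k N L : ℕ) (table : Str k → List ℕ) where

  Letter : Set
  Letter = Fin k ⊎ Bool

  -- While reading, up to `suc N` letters are remembered, one more than the table covers, so that a
  -- truncated prefix still reveals an input longer than `N`.
  State : Set
  State = Bounded (Fin k) (suc N) ⊎ Bounded Bool L ⊎ Fin k ⊎ Fin 6

  pattern reading b   = inj₁ b
  pattern printing b  = inj₂ (inj₁ b)
  pattern scanning a  = inj₂ (inj₂ (inj₁ a))
  pattern rewinding   = inj₂ (inj₂ (inj₂ 0F))
  pattern picking     = inj₂ (inj₂ (inj₂ 1F))
  pattern returning   = inj₂ (inj₂ (inj₂ 2F))
  pattern copying     = inj₂ (inj₂ (inj₂ 3F))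
  pattern finishing   = inj₂ (inj₂ (inj₂ 4F))
  pattern halted      = inj₂ (inj₂ (inj₂ 5F))

  pattern symbol a = just (inj₁ a)
  pattern bit b    = just (inj₂ b)

  Action : Set
  Action = Maybe (State × Vec (Cell Letter × Move) 3)

  decide : Str k → State
  decide s with length s ≤? N
  ... | yes _ = printing (truncate L (codeFlips (table s)))
  ... | no  _ = rewinding

  emit : List Bool → Cell Letter → Cell Letter → Cell Letter → Action
  emit []       i o w = just (finishing , (i , stay) ∷ (o , goLeft) ∷ (w , stay) ∷ [])
  emit (c ∷ cs) i o w = just (printing (truncate L cs) , (i , stay) ∷ (bit c , goRight) ∷ (w , stay) ∷ [])

  -- The `false` closes the unary index. Both heads step back onto the end of the block, or onto the
  -- blank before it if the block is empty.
  endScan : Cell Letter → Cell Letter → Action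
  endScan i w = just (returning , (i , goLeft) ∷ (bit false , goRight) ∷ (w , goLeft) ∷ [])

  -- A round deletes the first symbol a from the input tape, moves the block u
  -- up to the next a (or the end) to the work tape while emitting the flip, and
  -- copies it back in reverse.
  δ : State → Vec (Cell Letter) 3 → Action
  δ (reading b) (symbol a ∷ o ∷ w ∷ []) =
    just (reading (truncate (suc N) (toList (suc N) b ++ a ∷ [])) ,
          (symbol a , goRight) ∷ (o , stay) ∷ (w , stay) ∷ [])
  δ (reading b) (i ∷ o ∷ w ∷ []) =
    just (decide (toList (suc N) b) , (i , goLeft) ∷ (o , stay) ∷ (w , goRight) ∷ [])
  δ (printing b) (i ∷ o ∷ w ∷ []) = emit (toList L b) i o w
  δ rewinding (nothing ∷ o ∷ w ∷ []) = just (picking , (nothing , goRight) ∷ (o , stay) ∷ (w , stay) ∷ [])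
  δ rewinding (i ∷ o ∷ w ∷ []) = just (rewinding , (i , goLeft) ∷ (o , stay) ∷ (w , stay) ∷ [])
  δ picking (symbol a ∷ o ∷ w ∷ []) =
    just (scanning a , (nothing , goRight) ∷ (bit true , goRight) ∷ (w , stay) ∷ [])
  δ picking (i ∷ o ∷ w ∷ []) = just (finishing , (i , stay) ∷ (o , goLeft) ∷ (w , stay) ∷ [])
  δ (scanning a) (symbol b ∷ o ∷ w ∷ []) with a ≟ b
  ... | yes _ = endScan (symbol b) w
  ... | no  _ = just (scanning a , (symbol b , goRight) ∷ (bit true , goRight) ∷ (symbol b , goRight) ∷ [])
  δ (scanning a) (i ∷ o ∷ w ∷ []) = endScan i w
  δ returning (i ∷ o ∷ nothing ∷ []) = just (copying , (i , stay) ∷ (o , stay) ∷ (nothing , goRight) ∷ [])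
  δ returning (i ∷ o ∷ w ∷ []) = just (returning , (i , stay) ∷ (o , stay) ∷ (w , goLeft) ∷ [])
  δ copying (i ∷ o ∷ symbol b ∷ []) =
    just (copying , (symbol b , goLeft) ∷ (o , stay) ∷ (nothing , goRight) ∷ [])
  δ copying (i ∷ o ∷ w ∷ []) = just (picking , (i , goRight) ∷ (o , stay) ∷ (w , stay) ∷ [])
  δ finishing (i ∷ nothing ∷ w ∷ []) = just (halted , (i , stay) ∷ (nothing , goRight) ∷ (w , stay) ∷ [])
  δ finishing (i ∷ o ∷ w ∷ []) = just (finishing , (i , stay) ∷ (o , goLeft) ∷ (w , stay) ∷ [])
  δ halted _ = nothing

  machine : Machine (Fin k) Bool
  machine = record
    { work         = 1
    ; State        = State
    ; Γ            = Letter
    ; finite-State = finite-⊎ (finite-Bounded (finite-Fin k) (suc N)) (finite-⊎ (finite-Bounded finite-Bool L)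
                       (finite-⊎ (finite-Fin k) (finite-Fin 6)))
    ; finite-Γ     = finite-⊎ (finite-Fin k) finite-Bool
    ; inLetter     = mk↣ inj₁-injective
    ; outLetter    = mk↣ inj₂-injective
    ; start        = reading (truncate (suc N) [])
    ; δ            = δ
    }

  -- Runs of the machine, phase by phase

  Cells : Set
  Cells = List (Cell Letter)

  private
    variable
      i o w : Tape Letter
      l r out b : Cells

  symbols : Str k → Cells
  symbols = map symbol

  bits : List Bool → Cells
  bits = map bit

  conf : State → Tape Letter → Tape Letter → Tape Letter → Config machine
  conf q i o w = config q (i ∷ o ∷ w ∷ [])

  -- Unlike `_⇓[_]_`, these runs need not end in a halting configuration, so the phases can be
  -- composed.
  data _⟿[_]_ : Config machine → ℕ → Config machine → Set where
    []  : ∀ {c} → c ⟿[ 0 ] c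
    _∷_ : ∀ {c c′ c″ n} → stepConfig machine c ≡ just c′ → c′ ⟿[ n ] c″ → c ⟿[ suc n ] c″

  infixr 5 _◅◅_
  _◅◅_ : ∀ {c c′ c″ m n} → c ⟿[ m ] c′ → c′ ⟿[ n ] c″ → c ⟿[ m + n ] c″
  []      ◅◅ q = q
  (e ∷ p) ◅◅ q = e ∷ (p ◅◅ q)

  ⟿⇒⇓ : ∀ {c c′ n} → c ⟿[ n ] c′ → stepConfig machine c′ ≡ nothing → _⇓[_]_ machine c n c′
  ⟿⇒⇓ []      h = halt h
  ⟿⇒⇓ (e ∷ p) h = next e (⟿⇒⇓ p h)

  read-symbols : ∀ xs s →
    conf (reading (truncate (suc N) xs)) (fromHead l (symbols s)) o w
      ⟿[ length s ]
    conf (reading (truncate (suc N) (xs ++ s))) (tape (symbols s ʳ++ l) nothing []) o w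
  read-symbols xs [] rewrite ++-identityʳ xs = []
  read-symbols {l} xs (a ∷ s) rewrite sym (++-assoc xs (a ∷ []) s) =
    cong₂ (λ b t → just (conf (reading b) t _ _))
      (truncate-toList-++ (suc N) xs (a ∷ [])) (move-goRight l (symbol a) (symbols s))
    ∷ read-symbols (xs ++ a ∷ []) s

  -- Here `s` lists the letters from the head leftwards, so `ʳ++` restores the input. The additional
  -- step turns round on the blank before it, which stays behind as an explicit cell.
  rewind-input : ∀ s →
    conf rewinding (upToHead (symbols s) r) o w
      ⟿[ suc (length s) ]
    conf picking (fromHead [ nothing ] (symbols s ʳ++ r)) o w
  rewind-input {r} []      = cong (λ t → just (conf picking t _ _)) (move-goRight [] nothing r) ∷ []
  rewind-input {r} (a ∷ s) =
    cong (λ t → just (conf rewinding t _ _)) (move-goLeft (symbols s) (symbol a) r) ∷ rewind-input s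

  rewind-output : ∀ cs →
    conf finishing i (upToHead (bits cs) r) w
      ⟿[ suc (length cs) ]
    conf halted i (fromHead [ nothing ] (bits cs ʳ++ r)) w
  rewind-output {r = r} []       = cong (λ t → just (conf halted _ t _)) (move-goRight [] nothing r) ∷ []
  rewind-output {r = r} (c ∷ cs) =
    cong (λ t → just (conf finishing _ t _)) (move-goLeft (bits cs) (bit c) r) ∷ rewind-output cs

  print-bits : ∀ cs → length cs ≤ L →
    conf (printing (truncate L cs)) i (tape out nothing []) w
      ⟿[ suc (length cs) ]
    conf finishing i (upToHead (bits cs ʳ++ out) [ nothing ]) w
  print-bits {i} {out} {w} [] len = first ∷ []
    where
    first : stepConfig machine (conf (printing (truncate L [])) i (tape out nothing []) w)
            ≡ just (conf finishing i (upToHead out [ nothing ]) w)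
    first rewrite toList-truncate L (List Bool ∋ []) | take-all L (List Bool ∋ []) len =
      cong (λ t → just (conf finishing i t w)) (move-goLeft out nothing [])
  print-bits {i} {out} {w} (c ∷ cs) len = first ∷ print-bits cs (≤-trans (ℕ.n≤1+n _) len)
    where
    first : stepConfig machine (conf (printing (truncate L (c ∷ cs))) i (tape out nothing []) w)
            ≡ just (conf (printing (truncate L cs)) i (tape (bit c ∷ out) nothing []) w)
    first rewrite toList-truncate L (c ∷ cs) | take-all L (c ∷ cs) len = refl

  scan-block : ∀ {a} u → All (a ≢_) u →
    conf (scanning a) (fromHead l (symbols u ++ r)) (tape out nothing []) (tape b nothing [])
      ⟿[ length u ]
    conf (scanning a) (fromHead (symbols u ʳ++ l) r)
      (tape (bits (replicate (length u) true) ʳ++ out) nothing []) (tape (symbols u ʳ++ b) nothing [])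
  scan-block [] [] = []
  scan-block {l} {r} {out} {b} {a} (c ∷ u) (a≢c ∷ a∉u) = first ∷ scan-block u a∉u
    where
    first : stepConfig machine
              (conf (scanning a) (tape l (symbol c) (symbols u ++ r)) (tape out nothing []) (tape b nothing []))
            ≡ just (conf (scanning a) (fromHead (symbol c ∷ l) (symbols u ++ r))
                (tape (bit true ∷ out) nothing []) (tape (symbol c ∷ b) nothing []))
    first with a ≟ c
    ... | yes a≡c = contradiction a≡c a≢c
    ... | no  _   = cong (λ t → just (conf (scanning a) t _ _)) (move-goRight l (symbol c) (symbols u ++ r))

  -- Visited blanks become explicit list entries, so the blanks after the word are counted: for
  -- `m = 0` the step back leaves one behind.
  end-scan-absent : ∀ {a} m → ∃[ m′ ]
    conf (scanning a) (fromHead l (replicate m nothing)) (tape out nothing []) (tape b nothing [])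
      ⟿[ 1 ]
    conf returning (upToHead l (replicate m′ nothing))
      (tape (bit false ∷ out) nothing []) (upToHead b [ nothing ])
  end-scan-absent {l} {b = b} zero = 1 ,
    cong₂ (λ t t′ → just (conf returning t _ t′)) (move-goLeft l nothing []) (move-goLeft b nothing []) ∷ []
  end-scan-absent {l} {b = b} (suc m) = suc m ,
    cong₂ (λ t t′ → just (conf returning t _ t′))
      (move-goLeft l nothing (replicate m nothing)) (move-goLeft b nothing []) ∷ []

  end-scan-present : ∀ {a} →
    conf (scanning a) (fromHead l (symbol a ∷ r)) (tape out nothing []) (tape b nothing [])
      ⟿[ 1 ]
    conf returning (upToHead l (symbol a ∷ r)) (tape (bit false ∷ out) nothing []) (upToHead b [ nothing ])
  end-scan-present {l} {r} {out} {b} {a} = first ∷ []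
    where
    first : stepConfig machine (conf (scanning a) (tape l (symbol a) r) (tape out nothing []) (tape b nothing []))
            ≡ just (conf returning (upToHead l (symbol a ∷ r))
                (tape (bit false ∷ out) nothing []) (upToHead b [ nothing ]))
    first with a ≟ a
    ... | yes _  = cong₂ (λ t t′ → just (conf returning t _ t′)) (move-goLeft l (symbol a) r) (move-goLeft b nothing [])
    ... | no a≢a = contradiction refl a≢a

  return-work : ∀ u →
    conf returning i o (upToHead (symbols u ++ nothing ∷ b) r)
      ⟿[ suc (length u) ]
    conf copying i o (fromHead (nothing ∷ b) (symbols u ʳ++ r))
  return-work {b = b} {r} [] = cong (λ t → just (conf copying _ _ t)) (move-goRight b nothing r) ∷ []
  return-work {b = b} {r} (a ∷ u) =
    cong (λ t → just (conf returning _ _ t)) (move-goLeft (symbols u ++ nothing ∷ b) (symbol a) r)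
    ∷ return-work u

  -- The work head moves right while the input head moves left, which reverses the block; `v` is the
  -- old content of the overwritten cells. The cell before them is the blank left by the deleted
  -- letter.
  copy-block : ∀ u (v : Str k) → length v ≡ length u → ∃[ b′ ]
    conf copying (upToHead (symbols v ++ nothing ∷ l) r) o
         (fromHead (nothing ∷ b) (symbols u ++ [ nothing ]))
      ⟿[ suc (length u) ]
    conf picking (fromHead (nothing ∷ l) (symbols u ʳ++ r)) o (tape (nothing ∷ b′) nothing [])
  copy-block {l} {r} {b = b} [] [] _ = b ,
    cong (λ t → just (conf picking t _ _)) (move-goRight l nothing r) ∷ []
  copy-block {l} {r} {b = b} (a ∷ u) (c ∷ v) e
    with copy-block {l} {symbol a ∷ r} {b = nothing ∷ b} u v (ℕ.suc-injective e)
  ... | b′ , p = b′ ,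
    cong₂ (λ t t′ → just (conf copying t _ t′))
      (move-goLeft (symbols v ++ nothing ∷ l) (symbol a) r)
      (move-goRight (nothing ∷ b) nothing (symbols u ++ [ nothing ]))
    ∷ p

  symbols-++ : ∀ u v → symbols (u ++ v) ++ r ≡ symbols u ++ (symbols v ++ r)
  symbols-++ u v = trans (cong (_++ _) (map-++ symbol u v)) (++-assoc (symbols u) (symbols v) _)

  symbols-ʳ++ : ∀ u v → symbols (u ʳ++ v) ++ r ≡ symbols u ʳ++ (symbols v ++ r)
  symbols-ʳ++ []      v = refl
  symbols-ʳ++ (a ∷ u) v = symbols-ʳ++ u (a ∷ v)

  symbols-reverse-ʳ++ : ∀ u → symbols (reverse u) ʳ++ r ≡ symbols u ++ r
  symbols-reverse-ʳ++ u = trans (cong (_ʳ++ _) (reverse-map symbol u)) (reverse-ʳ++ (symbols u) _)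

  end-round : ∀ u → ∃[ b′ ]
    conf returning (upToHead (symbols u ʳ++ nothing ∷ l) r) o (upToHead (symbols u ʳ++ nothing ∷ b) [ nothing ])
      ⟿[ suc (length u) + suc (length u) ]
    conf picking (fromHead (nothing ∷ l) (symbols u ʳ++ r)) o (tape (nothing ∷ b′) nothing [])
  end-round {l} {r} {o} {b = b} u
    -- Seen from the heads, the block lies to the left in reverse order; both tapes are brought into
    -- the form with `reverse u` that the two phases expect.
    rewrite sym (symbols-ʳ++ {nothing ∷ l} u []) | sym (symbols-ʳ++ {nothing ∷ b} u [])
    with copy-block {l} {r} {o} {b} u (reverse u) (length-reverse u)
       | return-work {upToHead (symbols (reverse u) ++ nothing ∷ l) r} {o} {b} {[ nothing ]} (reverse u)
  ... | b′ , copied | returned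
    rewrite length-reverse u | symbols-reverse-ʳ++ {[ nothing ]} u = b′ , returned ◅◅ copied

  flipCode : ℕ → List Bool
  flipCode n = replicate n true ++ false ∷ []

  bits-flipCode : ∀ n →
    bits (flipCode (suc n)) ʳ++ out ≡ bit false ∷ (bits (replicate n true) ʳ++ bit true ∷ out)
  bits-flipCode {out} n = trans
    (cong (_ʳ++ bit true ∷ out) (map-++ bit (replicate n true) (false ∷ [])))
    (++-ʳ++ (bits (replicate n true)))

  -- The summands are one step for picking, `n` for scanning, one for ending the scan, and `suc n`
  -- each for returning and copying.
  roundTime : ℕ → ℕ
  roundTime n = suc (n + suc (suc n + suc n))

  -- The picked letter contributes the first `true` and every letter of the block one more, which
  -- gives the index `suc (length (block p))`.
  round : ∀ {a s} (p : Split a s) m → ∃[ m′ ] ∃[ b′ ]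
    conf picking (fromHead l (symbols (a ∷ s) ++ replicate m nothing))
         (tape out nothing []) (tape (nothing ∷ b) nothing [])
      ⟿[ roundTime (length (block p)) ]
    conf picking (fromHead (nothing ∷ l) (symbols (next-round p) ++ replicate m′ nothing))
         (tape (bits (flipCode (suc (length (block p)))) ʳ++ out) nothing []) (tape (nothing ∷ b′) nothing [])
  round {l} {out} {b} {a} (absent u a∉u) m
    with end-scan-absent {symbols u ʳ++ nothing ∷ l} {bits (replicate (length u) true) ʳ++ bit true ∷ out}
           {symbols u ʳ++ nothing ∷ b} {a} m
  ... | m′ , stopped with end-round {l} {replicate m′ nothing} {b = b} u
  ...   | b′ , copied
    rewrite bits-flipCode {out} (length u) | sym (symbols-ʳ++ {replicate m′ nothing} u []) =
    m′ , b′ ,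
    cong (λ t → just (conf (scanning a) t _ _)) (move-goRight l nothing (symbols u ++ replicate m nothing))
    ∷ (scan-block u a∉u ◅◅ stopped ◅◅ copied)
  round {l} {out} {b} {a} (present u a∉u v) m
    with end-round {l} {symbol a ∷ symbols v ++ replicate m nothing} {b = b} u
  ... | b′ , copied
    rewrite bits-flipCode {out} (length u)
          | sym (symbols-ʳ++ {replicate m nothing} u (a ∷ v))
          | symbols-++ {replicate m nothing} u (a ∷ v) =
    m , b′ ,
    cong (λ t → just (conf (scanning a) t _ _)) (move-goRight l nothing _)
    ∷ (scan-block u a∉u ◅◅ end-scan-present ◅◅ copied)

  roundTime-≤ : ∀ {m n} → m ≤ n → roundTime m ≤ 3 * n + 4
  roundTime-≤ {m} {n} m≤n = begin
    roundTime m
      ≡⟨ solve 1 (λ m → con 1 :+ (m :+ (con 1 :+ ((con 1 :+ m) :+ (con 1 :+ m)))) := con 3 :* m :+ con 4) refl m ⟩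
    3 * m + 4    ≤⟨ ℕ.+-monoˡ-≤ 4 (ℕ.*-monoʳ-≤ 3 m≤n) ⟩
    3 * n + 4    ∎
    where open ≤-Reasoning

  -- `M` stays fixed while `n` decreases, so that every round obeys the same bound `3 * M + 4`; the
  -- last step is the one that finds no letter to pick.
  simulate : ∀ {M} n x m → length x ≡ n → n ≤ M → ∃[ t ] ∃[ i ] ∃[ w ] (t ≤ suc (n * (3 * M + 4)) ×
    conf picking (fromHead l (symbols x ++ replicate m nothing)) (tape out nothing []) (tape (nothing ∷ b) nothing [])
      ⟿[ t ]
    conf finishing i (upToHead (bits (codeFlips (greedy n x)) ʳ++ out) [ nothing ]) w)
  simulate {out = out} zero [] zero _ _ = 1 , _ , _ , s≤s z≤n ,
    cong (λ t → just (conf finishing _ t _)) (move-goLeft out nothing []) ∷ []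
  simulate {out = out} zero [] (suc m) _ _ = 1 , _ , _ , s≤s z≤n ,
    cong (λ t → just (conf finishing _ t _)) (move-goLeft out nothing []) ∷ []
  simulate {l} {out} {b} {M} (suc n) (a ∷ s) m e n<M with round {l} {out} {b} (split a s) m
  ... | m′ , b′ , first
    with simulate {nothing ∷ l} {bits (flipCode (suc (length (block (split a s))))) ʳ++ out} {b′} n
           (next-round (split a s)) m′ (trans (length-next-round (split a s)) (ℕ.suc-injective e))
           (≤-trans (ℕ.n≤1+n n) n<M)
  ...   | t , i , w , t≤ , rest = _ , i , w ,
    ≤-trans (ℕ.+-mono-≤ (roundTime-≤ (≤-trans (length-block-≤ (split a s))
                (≤-trans (ℕ.≤-reflexive (ℕ.suc-injective e)) (≤-trans (ℕ.n≤1+n n) n<M)))) t≤)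
            (ℕ.≤-reflexive (ℕ.+-suc (3 * M + 4) (n * (3 * M + 4)))) ,
    first ◅◅ subst (λ z → _ ⟿[ t ] conf finishing i (upToHead z [ nothing ]) w) (sym out≡) rest
    where
    c = flipCode (suc (length (block (split a s))))
    cs = codeFlips (greedy n (next-round (split a s)))
    out≡ : bits (c ++ cs) ʳ++ out ≡ bits cs ʳ++ (bits c ʳ++ out)
    out≡ = trans (cong (_ʳ++ out) (map-++ bit c cs)) (++-ʳ++ (bits c))

  -- The complete run: answer, output and running time

  answer : Str k → List ℕ
  answer s with length s ≤? N
  ... | yes _ = table s
  ... | no  _ = greedy (length s) s

  -- A string of length at most `N` is kept whole; a longer one leaves exactly `suc N` letters,
  -- which is still more than `N`.
  decide-truncate : ∀ s → decide (toList (suc N) (truncate (suc N) s)) ≡ decide s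
  decide-truncate s rewrite toList-truncate (suc N) s with length s ≤? N
  ... | yes len rewrite take-all (suc N) s (ℕ.m≤n⇒m≤1+n len) with length s ≤? N
  ...   | yes _   = refl
  ...   | no ¬len = contradiction len ¬len
  decide-truncate s | no ¬len with length (take (suc N) s) ≤? N
  ... | no _     = refl
  ... | yes len′ = contradiction
    (subst (_≤ N) (trans (length-take (suc N) s) (ℕ.m≤n⇒m⊓n≡m (ℕ.≰⇒> ¬len))) len′) ℕ.1+n≰n

  finish : ∀ cs →
    conf finishing i (upToHead (bits cs ʳ++ []) [ nothing ]) w
      ⟿[ suc (length cs) ]
    conf halted i (fromHead [ nothing ] (bits cs ++ [ nothing ])) w
  finish {i} {w} cs with rewind-output {i} {[ nothing ]} {w} (reverse cs)
  ... | rewound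
    rewrite length-reverse cs | reverse-map {B = Cell Letter} bit cs | reverse-ʳ++ (bits cs) [ nothing ] = rewound

  bits-outputs : ∀ {i w} cs → outputs machine (conf halted i (fromHead [ nothing ] (bits cs ++ [ nothing ])) w) cs
  bits-outputs {i} {w} cs = trans
    (cong (λ z → tapeWord (fromHead [ nothing ] (z ++ [ nothing ]))) (map-∘ cs))
    (tapeWord-fromHead [ nothing ] (map inj₂ cs) [])

  -- A common bound for both branches. Reading takes `n + 1` steps and the final return of the
  -- output head `suc m`. In between, printing takes `suc m`, or else rewinding takes `suc n` and
  -- the simulation at most `suc (n * (3 * n + 4))`.
  runningTime : ℕ → ℕ → ℕ
  runningTime n m = (n + 1) + ((suc n + suc (n * (3 * n + 4)) + suc m) + suc m)

  -- The last step also moves the work head right, so that the blank at which `returning` stops is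
  -- an explicit cell from the first round on.
  read-input : ∀ s {q} → decide s ≡ q →
    initial machine s
      ⟿[ length s + 1 ]
    conf q (upToHead (symbols s ʳ++ []) [ nothing ]) blankTape (tape [ nothing ] nothing [])
  read-input s refl rewrite wordTape-fromHead {Letter} (map inj₁ s) | sym (map-∘ {g = just} {inj₁ {B = Bool}} s) =
    read-symbols [] s
    ◅◅ cong₂ (λ q t → just (conf q t blankTape (tape [ nothing ] nothing [])))
         (decide-truncate s) (move-goLeft (symbols s ʳ++ []) nothing [])
    ∷ []

  computes : ∀ s → (length s ≤ N → length (codeFlips (table s)) ≤ L) →
             ∃[ n ] (n ≤ runningTime (length s) (length (codeFlips (answer s))) ×
                     ComputesIn machine n s (codeFlips (answer s)))
  computes s bounded with length s ≤? N in eq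
  ... | yes len =
    _ , ℕ.+-monoʳ-≤ (length s + 1) (ℕ.+-monoˡ-≤ (suc (length flips))
          (ℕ.m≤n+m _ (suc (length s) + suc (length s * (3 * length s + 4))))) ,
    _ , ⟿⇒⇓ (read-input s decided ◅◅ print-bits flips (bounded len) ◅◅ finish flips) refl ,
    bits-outputs {upToHead (symbols s ʳ++ []) [ nothing ]} {tape [ nothing ] nothing []} flips
    where
    flips : List Bool
    flips = codeFlips (table s)
    decided : decide s ≡ printing (truncate L (codeFlips (table s)))
    decided rewrite eq = refl
  ... | no ¬len
    -- Reading went one cell past the word and rewinding one cell before it; this accounts for the
    -- single blank on either side.
    with simulate {[ nothing ]} {[]} {[]} (length s) s 1 refl ≤-refl
       | rewind-input {[ nothing ]} {blankTape} {tape [ nothing ] nothing []} (reverse s)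
  ...   | t , i , w , t≤ , simulated | rewound
    rewrite length-reverse s
          | symbols-reverse-ʳ++ {[ nothing ]} s | reverse-map {B = Cell Letter} symbol s =
    _ , ℕ.+-monoʳ-≤ (length s + 1) (
          ≤-trans (ℕ.≤-reflexive (sym (ℕ.+-assoc (suc (length s)) t _)))
            (ℕ.+-mono-≤ (≤-trans (ℕ.+-monoʳ-≤ (suc (length s)) t≤) (ℕ.m≤m+n _ _)) ≤-refl)) ,
    _ , ⟿⇒⇓ (read-input s decided ◅◅ rewound ◅◅ simulated ◅◅ finish flips) refl ,
    bits-outputs {i} {w} flips
    where
    flips : List Bool
    flips = codeFlips (greedy (length s) s)
    decided : decide s ≡ rewinding
    decided rewrite eq = refl

-- The approximation scheme

module _ {k : ℕ} where

  -- The sequence is chosen before `k′` is known: it is a shortest one reaching the length of the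
  -- greedy result, and that length equals every `k′` for which `s` is fully `k′`-ary. The greedy
  -- sequence guarantees that the search ends.
  optimal : ∀ {s : Str k} → Normalized s →
    Σ[ is ∈ List ℕ ] (∀ {k′} → FullyAry k′ s → GroupedBy k′ s is × IsGroupingDistance k′ s (length is))
  optimal {s} l with grouped l
  ... | t , r , ut
    with least (λ d → groupable? (length t) d s) _ (greedy (length s) s , (t , r , refl) , refl)
  ...   | d , (is , g , refl) , min = is , λ full →
      subst (λ k′ → GroupedBy k′ s is × IsGroupingDistance k′ s (length is))
        (length-Unique-FullyAry ut (FullyAry-⟶ r full))
        (g , (is , g , refl) , λ js gj → min (length js) (js , gj , refl))

  table : Str k → List ℕ
  table s with linked? (λ a b → ¬? (a ≟ b)) s
  ... | yes l = proj₁ (optimal l)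
  -- A default value; such strings violate the promise.
  ... | no  _ = []

  table-optimal : ∀ {k′} {s : Str k} → Normalized s → FullyAry k′ s →
    GroupedBy k′ s (table s) × IsGroupingDistance k′ s (length (table s))
  table-optimal {s = s} l full with linked? (λ a b → ¬? (a ≟ b)) s
  ... | yes l′ = proj₂ (optimal l′) full
  ... | no ¬l  = contradiction l ¬l

  length-codeFlips-≤ : ∀ {n} is → All (_≤ n) is → length (codeFlips is) ≤ length is * suc n
  length-codeFlips-≤ [] [] = z≤n
  length-codeFlips-≤ {n} (i ∷ is) (i≤n ∷ is≤n) = begin
    length ((replicate i true ++ false ∷ []) ++ codeFlips is)          ≡⟨ length-++ (replicate i true ++ false ∷ []) ⟩
    length (replicate i true ++ false ∷ []) + length (codeFlips is)
      ≡⟨ cong (_+ length (codeFlips is)) (length-++ (replicate i true)) ⟩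
    length (replicate i true) + 1 + length (codeFlips is)
      ≡⟨ cong (λ m → m + 1 + length (codeFlips is)) (length-replicate i) ⟩
    i + 1 + length (codeFlips is)
      ≤⟨ ℕ.+-mono-≤ (ℕ.≤-trans (ℕ.≤-reflexive (ℕ.+-comm i 1)) (s≤s i≤n)) (length-codeFlips-≤ is is≤n) ⟩
    suc n + length is * suc n                                          ∎
    where open ≤-Reasoning

  length-code-≤ : ∀ {k′} {s : Str k} {is} → GroupedBy k′ s is → length is ≤ length s →
                  length (codeFlips is) ≤ length s * suc (length s)
  length-code-≤ {s = s} {is} (_ , r , _) is≤ =
    ≤-trans (length-codeFlips-≤ is (indices-≤ r)) (ℕ.*-monoˡ-≤ (suc (length s)) is≤)

  distance-≤-length : ∀ {k′} {s : Str k} {d} → Normalized s → FullyAry k′ s →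
                      IsGroupingDistance k′ s d → d ≤ length s
  distance-≤-length {s = s} {d} l full (_ , min) =
    subst (d ≤_) (length-greedy (length s) s refl) (min _ (greedy-GroupedBy l full))

  length-≤-distance : ∀ {k′} {s : Str k} {d} → Normalized s → IsGroupingDistance k′ s d → length s ≤ d + k′
  length-≤-distance l ((is , (t , r , refl) , refl) , _) = length-⟶-≥ l r

-- For ε = (p + 1)/(q + 1) the last hypothesis says j ≤ ε d, whence n ≤ d + j ≤ (1 + ε) d. Over
-- unnormalised rationals this is the cross-multiplied inequality `n * suc q ≤ (suc q + suc p) * d`.
approximation : ∀ {p q} .(c : Coprime (suc p) (suc q)) j {n d} → n ≤ d + j → j * suc q ≤ suc p * d →
                (+ n / 1) ≤ℚ (1ℚ +ℚ mkℚ (+ suc p) q c) *ℚ (+ d / 1)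
approximation {p} {q} c j {n} {d} n≤d+j j≤ = ℚ.toℚᵘ-cancel-≤ (begin
  ℚ.toℚᵘ (+ n / 1)                                              ≃⟨ ℚ.toℚᵘ-fromℚᵘ (mkℚᵘ (+ n) 0) ⟩
  mkℚᵘ (+ n) 0                                                  ≤⟨ *≤* (subst₂ ℤ._≤_ lhs≡ rhs≡ (ℤ.+≤+ n≤)) ⟩
  (ℚᵘ.1ℚᵘ ℚᵘ.+ mkℚᵘ (+ suc p) q) ℚᵘ.* mkℚᵘ (+ d) 0
    ≃⟨ ℚᵘ.*-cong (ℚᵘ.≃-sym (ℚ.toℚᵘ-homo-+ 1ℚ (mkℚ (+ suc p) q c))) (ℚᵘ.≃-sym (ℚ.toℚᵘ-fromℚᵘ (mkℚᵘ (+ d) 0))) ⟩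
  ℚ.toℚᵘ (1ℚ +ℚ mkℚ (+ suc p) q c) ℚᵘ.* ℚ.toℚᵘ (+ d / 1)
    ≃⟨ ℚᵘ.≃-sym (ℚ.toℚᵘ-homo-* (1ℚ +ℚ mkℚ (+ suc p) q c) (+ d / 1)) ⟩
  ℚ.toℚᵘ ((1ℚ +ℚ mkℚ (+ suc p) q c) *ℚ (+ d / 1))               ∎)
  where
  open ℚᵘ.≤-Reasoning
  sum = ℚᵘ.1ℚᵘ ℚᵘ.+ mkℚᵘ (+ suc p) q
  lhs≡ : + (n * suc q) ≡ + n ℤ.* ℚᵘ.↧ (sum ℚᵘ.* mkℚᵘ (+ d) 0)
  lhs≡ = trans (ℤ.pos-* n (suc q)) (cong (λ m → + n ℤ.* + suc m) (solve 1 (λ q → q := (q :+ con 0) :* con 1) refl q))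
  rhs≡ : + ((suc q + suc p) * d) ≡ ℚᵘ.↥ (sum ℚᵘ.* mkℚᵘ (+ d) 0) ℤ.* + 1
  rhs≡ = trans (ℤ.pos-* (suc q + suc p) d)
    (trans (cong (λ m → + m ℤ.* + d) (solve 2 (λ p q → (con 1 :+ q) :+ (con 1 :+ p)
        := (con 1 :+ (q :+ con 0)) :+ (con 1 :+ (p :* con 1))) refl p q))
    (sym (ℤ.*-identityʳ _)))
  n≤ : n * suc q ≤ (suc q + suc p) * d
  n≤ = ℕ.≤-trans (ℕ.*-monoˡ-≤ (suc q) n≤d+j)
    (ℕ.≤-trans (ℕ.≤-reflexive (trans (ℕ.*-distribʳ-+ (suc q) d j) (cong (_+ j * suc q) (ℕ.*-comm d (suc q)))))
    (ℕ.≤-trans (ℕ.+-monoʳ-≤ (suc q * d) j≤) (ℕ.≤-reflexive (sym (ℕ.*-distribʳ-+ d (suc q) (suc p))))))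

-- Here `m` is the length of the output: at most `n` indices, each coded by at most `suc n` letters.
-- Inserting this bound gives 5n² + 8n + 5, and n ≤ n² does the rest.
runningTime-≤ : ∀ n m → m ≤ n * suc n →
  (n + 1) + ((suc n + suc (n * (3 * n + 4)) + suc m) + suc m) ≤ 13 * n ^ 2 + 13
runningTime-≤ n m m≤ = begin
  (n + 1) + ((suc n + suc (n * (3 * n + 4)) + suc m) + suc m)
    ≤⟨ ℕ.+-monoʳ-≤ (n + 1) (ℕ.+-mono-≤ (ℕ.+-monoʳ-≤ (suc n + suc (n * (3 * n + 4))) (s≤s m≤)) (s≤s m≤)) ⟩
  (n + 1) + ((suc n + suc (n * (3 * n + 4)) + suc (n * suc n)) + suc (n * suc n))
    ≡⟨ solve 1 (λ n → (n :+ con 1) :+ ((((con 1 :+ n) :+ (con 1 :+ n :* (con 3 :* n :+ con 4)))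
         :+ (con 1 :+ n :* (con 1 :+ n))) :+ (con 1 :+ n :* (con 1 :+ n)))
         := con 8 :* n :+ (con 5 :* (n :* (n :* con 1)) :+ con 5)) refl n ⟩
  8 * n + (5 * n ^ 2 + 5)
    ≤⟨ ℕ.+-mono-≤ (ℕ.*-monoʳ-≤ 8 (n≤n² n)) (ℕ.+-monoʳ-≤ (5 * n ^ 2) (ℕ.m≤m+n 5 8)) ⟩
  8 * n ^ 2 + (5 * n ^ 2 + 13)
    ≡⟨ solve 1 (λ m → con 8 :* m :+ (con 5 :* m :+ con 13) := con 13 :* m :+ con 13) refl (n ^ 2) ⟩
  13 * n ^ 2 + 13 ∎
  where
  open ≤-Reasoning
  n≤n² : ∀ n → n ≤ n ^ 2
  n≤n² zero      = z≤n
  n≤n² n@(suc _) = ℕ.m≤m*n n (n * 1)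

theorem3p7 : ∀ (k : ℕ) (ε : ℚ) → 2 ≤ k → 0ℚ <ℚ ε →
    PolyTimeSolvable codeFlips
    (λ (s : Str k) → Normalized s × ∃[ k′ ] FullyAry k′ s)
    (λ s is → ∀ k′ → FullyAry k′ s →
    GroupedBy k′ s is ×
    ∃[ d ] (IsGroupingDistance k′ s d ×
    (+ length is / 1) ≤ℚ (1ℚ +ℚ ε) *ℚ (+ d / 1)))
theorem3p7 k (mkℚ +0       q c) _ (*<* (ℤ.+<+ ()))
theorem3p7 k (mkℚ -[1+ p ] q c) _ (*<* ())
theorem3p7 k ε@(mkℚ (+ suc p) q c) _ _ = machine , 13 , 2 , solves
  where
  N : ℕ
  -- If `length s` exceeds `N`, then d ≥ `length s` - k ≥ k (q + 1), hence ε d ≥ k because ε ≥ 1/(q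
  -- + 1).
  N = k * suc q + k

  -- A table entry has at most `N` indices, each at most `N`, so its code has at most `N * suc N`
  -- letters.
  open GreedyMachine k N (N * suc N) table

  Approximate : Str k → List ℕ → Set
  Approximate s is = ∀ k′ → FullyAry k′ s → GroupedBy k′ s is ×
    ∃[ d ] (IsGroupingDistance k′ s d × (+ length is / 1) ≤ℚ (1ℚ +ℚ ε) *ℚ (+ d / 1))

  answer-Approximate : ∀ {s} → Normalized s → Approximate s (answer s)
  answer-Approximate {s} l k′ full with length s ≤? N | table-optimal l full
  -- Table answers are optimal, so the additive error is 0.
  ... | yes _   | g , opt = g , length (table s) , opt ,
    approximation c 0 {length (table s)} {length (table s)} (ℕ.m≤m+n _ 0) z≤n
  ... | no  s≰N | _ , opt = greedy-GroupedBy l full , d , opt , approximation c k {d = d} n≤d+k k≤d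
    where
    d : ℕ
    d = length (table s)
    |s|≤d+k : length s ≤ d + k
    -- Weakening `k′` to `k` makes the additive error the same for all strings.
    |s|≤d+k = ≤-trans (length-≤-distance l opt) (ℕ.+-monoʳ-≤ d (proj₁ full))
    n≤d+k : length (greedy (length s) s) ≤ d + k
    n≤d+k = subst (_≤ d + k) (sym (length-greedy (length s) s refl)) |s|≤d+k
    k≤d : k * suc q ≤ suc p * d
    k≤d = ≤-trans (ℕ.+-cancelʳ-≤ k _ _ (≤-trans (ℕ.<⇒≤ (ℕ.≰⇒> s≰N)) |s|≤d+k)) (ℕ.m≤n*m d (suc p))

  length-answer-≤ : ∀ {k′ s} → Normalized s → FullyAry k′ s → length (answer s) ≤ length s
  length-answer-≤ {s = s} l full with length s ≤? N
  ... | yes _ = distance-≤-length l full (proj₂ (table-optimal l full))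
  ... | no  _ = ℕ.≤-reflexive (length-greedy (length s) s refl)

  solves : ∀ s → Normalized s × ∃[ k′ ] FullyAry k′ s →
    Σ[ is ∈ List ℕ ] ∃[ n ] (ComputesIn machine n s (codeFlips is) × n ≤ 13 * length s ^ 2 + 13 × Approximate s is)
  solves s (l , k′ , full) with computes s (λ s≤N →
      ≤-trans (length-code-≤ (proj₁ (table-optimal l full)) (distance-≤-length l full (proj₂ (table-optimal l full))))
              (ℕ.*-mono-≤ s≤N (s≤s s≤N)))
  ... | n , n≤ , run = answer s , n , run ,
    ≤-trans n≤ (runningTime-≤ (length s) (length (codeFlips (answer s)))
      (length-code-≤ (proj₁ (answer-Approximate l k′ full)) (length-answer-≤ l full))) ,
    answer-Approximate l
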